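{- Let $A$ be a set, let $P,Q,R,U,W$ be predicates on $A$, and let $S$ be a binary relation on $A$. Then: (a) $\{P\lor R\}S\{Q\}\ \Leftrightarrow\ \{P\}S\{Q\}\land\{R\}S\{Q\}$; (b) $\{P\}S\{Q\land R\}\ \Leftrightarrow\ \{P\}S\{Q\}\land\{P\}S\{R\}$; (c) $\{P\lor U\}S\{Q\land W\}\ \Leftrightarrow\ \{P\}S\{Q\}\land\{U\}S\{W\}\land\{P\}S\{W\}\land\{U\}S\{Q\}$; (d) $\{P\}S\{Q\}\lor\{P\}S\{W\}\ \Rightarrow\ \{P\}S\{Q\lor W\}$.
   Context: $A$ is an arbitrary set (the abstract state space); all quantified variables range over $A$. An $S$-predicate is a predicate $P:A\to\{\top,\bot\}$; an $S$-relation is an arbitrary binary relation $S\subseteq A\times A$, with $S(x,y)$ meaning $(x,y)\in S$ (neither totality nor determinism is assumed). Logical connectives applied to predicates are taken pointwise. The total correctness formula $\{P\}S\{Q\}$ abbreviates $$\forall x\,[P(x)\Rightarrow(\exists y\,S(x,y)\ \land\ \forall z\,(S(x,z)\Rightarrow Q(z)))].$$ The logic is classical first-order predicate logic. -}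

module Defs where

open import Level using (Level; _⊔_)
open import Data.Product using (_×_; ∃-syntax)
open import Relation.Binary.Core using (Rel)
open import Relation.Unary using (Pred)

private
  variable
    a p q s : Level

-- Hoare triple {P}S{Q} (braces are reserved) for total correctness: from every
-- state satisfying P some step exists, and every step leads to Q.
⟪_⟫_⟪_⟫ : {A : Set a} → Pred A p → Rel A s → Pred A q → Set (a ⊔ p ⊔ q ⊔ s)
⟪ P ⟫ S ⟪ Q ⟫ = ∀ x → P x → (∃[ y ] S x y) × (∀ z → S x z → Q z)

{-# OPTIONS --safe #-}
module Submission where

open import Defs
open import Level using (Level)
open import Data.Product using (_×_; _,_; proj₁; proj₂; map₂)
open import Data.Sum using (_⊎_; inj₁; inj₂; [_,_]′)
open import Function.Bundles using (_⇔_; mk⇔; module Equivalence)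
open import Relation.Binary.Core using (Rel)
open import Relation.Unary using (Pred; _∪_; _∩_; _⊆_)

open Equivalence using (to; from)

private
  variable
    a p q r s : Level
    A : Set a
    P : Pred A p
    Q : Pred A q
    R : Pred A r
    S : Rel A s

-- For fixed `x` the triple is an implication from `P x` whose conclusion mentions `Q` only under
-- `∀ z`. So it is antitone in `P` and monotone in `Q`. A union on the left becomes a product
-- (`∪-pre`), and an intersection on the right distributes over the implications and `∀ z`
-- (`∩-post`).

strengthen-pre : R ⊆ P → ⟪ P ⟫ S ⟪ Q ⟫ → ⟪ R ⟫ S ⟪ Q ⟫
strengthen-pre R⊆P h x Rx = h x (R⊆P Rx)

weaken-post : Q ⊆ R → ⟪ P ⟫ S ⟪ Q ⟫ → ⟪ P ⟫ S ⟪ R ⟫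
weaken-post Q⊆R h x Px = map₂ (λ post z Sxz → Q⊆R (post z Sxz)) (h x Px)

∪-pre : ⟪ P ∪ R ⟫ S ⟪ Q ⟫ ⇔ (⟪ P ⟫ S ⟪ Q ⟫ × ⟪ R ⟫ S ⟪ Q ⟫)
∪-pre = mk⇔
  (λ h → strengthen-pre inj₁ h , strengthen-pre inj₂ h)
  (λ (f , g) x → [ f x , g x ]′)

∩-post : ⟪ P ⟫ S ⟪ Q ∩ R ⟫ ⇔ (⟪ P ⟫ S ⟪ Q ⟫ × ⟪ P ⟫ S ⟪ R ⟫)
∩-post = mk⇔
  (λ h → weaken-post proj₁ h , weaken-post proj₂ h)
  -- The existence of a successor does not involve the postcondition, so the witness of `f` serves
  -- for both.
  (λ (f , g) x Px → map₂ (λ post z Sxz → post z Sxz , proj₂ (g x Px) z Sxz) (f x Px))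

theorem3p4 : ∀ {a p q r u w s : Level} {A : Set a}
    (P : Pred A p) (Q : Pred A q) (R : Pred A r) (U : Pred A u) (W : Pred A w)
    (S : Rel A s) →
    (⟪ P ∪ R ⟫ S ⟪ Q ⟫ ⇔ (⟪ P ⟫ S ⟪ Q ⟫ × ⟪ R ⟫ S ⟪ Q ⟫)) ×
    (⟪ P ⟫ S ⟪ Q ∩ R ⟫ ⇔ (⟪ P ⟫ S ⟪ Q ⟫ × ⟪ P ⟫ S ⟪ R ⟫)) ×
    (⟪ P ∪ U ⟫ S ⟪ Q ∩ W ⟫ ⇔
    (⟪ P ⟫ S ⟪ Q ⟫ × ⟪ U ⟫ S ⟪ W ⟫ × ⟪ P ⟫ S ⟪ W ⟫ × ⟪ U ⟫ S ⟪ Q ⟫)) ×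
    ((⟪ P ⟫ S ⟪ Q ⟫ ⊎ ⟪ P ⟫ S ⟪ W ⟫) → ⟪ P ⟫ S ⟪ Q ∪ W ⟫)
theorem3p4 P Q R U W S =
    ∪-pre
  , ∩-post
  , mk⇔
      -- Splitting the precondition, then each postcondition, gives the four triples.
      (λ h → let hP , hU = to ∪-pre h
                 PQ , PW = to ∩-post hP
                 UQ , UW = to ∩-post hU
             in PQ , UW , PW , UQ)
      (λ (PQ , UW , PW , UQ) →
        from ∪-pre (from ∩-post (PQ , PW) , from ∩-post (UQ , UW)))
  -- Monotonicity gives one direction only: distinct successors may satisfy distinct disjuncts.
  , [ weaken-post inj₁ , weaken-post inj₂ ]′
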